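{- Let $\ell, k$ be integers with $2 \le \ell \le k$, and let $\alpha_\ell^k = (*, \dots, *, 1, *, \dots, *) \in (\mathbb{F}_2 \cup \{*\})^k$ be the vector whose $\ell$-th coordinate is $1$ and whose other $k-1$ coordinates are all $*$. Then the sequence $\bigl(g_{\alpha_\ell^k}(n)\bigr)_{n \ge 1}$ is bounded if and only if $\ell$ is a power of $2$.
   Context: Write $[n] = \{1, \dots, n\}$ and let $2^{[n]}$ be its power set. For $\alpha = (\alpha_1, \dots, \alpha_k) \in (\mathbb{F}_2 \cup \{*\})^k$, a set family $\mathcal{F}$ is an $\alpha$-ville if for each $i = 1, \dots, k$ with $\alpha_i \in \mathbb{F}_2$, the congruence \[ |F_1 \cap \dots \cap F_i| + |F_1 \cup \dots \cup F_i| \equiv \alpha_i \pmod 2 \] holds for any $i$ distinct members $F_1, \dots, F_i \in \mathcal{F}$; a coordinate $\alpha_i = *$ imposes no restriction. Let $g_\alpha(n)$ be the maximum of $|\mathcal{F}|$ over all $\alpha$-villes $\mathcal{F} \subseteq 2^{[n]}$. -}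

module Defs where

open import Data.Bool.Base using (if_then_else_)
open import Data.Fin.Base using (Fin; toℕ; funToFin; finToFun)
open import Data.Fin.Properties using (2↔Bool; finToFun-funToFin; injective⇒≤; all?)
open import Data.Fin.Subset using (Subset; ⋂; ⋃; ∣_∣)
open import Data.Fin.Subset.Properties using (anySubset?)
open import Data.Maybe.Base using (Maybe; just; nothing)
import Data.Maybe.Relation.Unary.All as Maybe
open import Data.Nat.Base using (ℕ; zero; suc; parity; _+_; _^_; _≤_; _<_; s≤s⁻¹)
open import Data.Nat.Properties using (m≤n⇒m<n∨m≡n)
import Data.Nat.Properties as ℕ
open import Data.Parity.Base using (Parity; 1ℙ)
import Data.Parity.Properties as ℙ
import Data.Bool.Properties as 𝔹
open import Data.Product.Base using (_×_; _,_; ∃; proj₁; proj₂)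
open import Data.Sum.Base using (_⊎_; inj₁; inj₂)
open import Data.Vec.Base using (Vec; []; _∷_; lookup; tabulate; toList)
open import Data.Vec.Functional using (Vector)
import Data.Vec.Properties as Vec
open import Data.Vec.Membership.Propositional using (_∈_)
open import Data.Vec.Relation.Unary.All using (All)
import Data.Vec.Relation.Unary.All as All
import Data.Vec.Relation.Unary.AllPairs as AllPairs
import Data.Vec.Relation.Unary.Any as Any
open import Data.Vec.Relation.Unary.Unique.Propositional using (Unique)
open import Data.Vec.Relation.Unary.Unique.Propositional.Properties using (lookup-injective)
open import Function.Base using (_∘_)
open import Function.Bundles using (Inverse)
open import Relation.Binary.Definitions using (DecidableEquality)
open import Relation.Binary.PropositionalEquality
  using (_≡_; refl; sym; trans; cong; module ≡-Reasoning)
open import Relation.Nullary.Decidable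
  using (Dec; yes; no; does; map′; ¬?; _×-dec_; _→-dec_; decidable-stable)
open import Relation.Nullary.Negation using (contradiction)
open import Relation.Unary using (Decidable)

private
  variable
    k m n : ℕ

-- 𝔽₂ ∪ {*}, where 𝔽₂ is `Parity` and * is `nothing`.
𝔽₂∪* : Set
𝔽₂∪* = Maybe Parity

-- A family of m distinct subsets of an n-element set is a duplicate-free
-- vector of length m; `IsVille` itself does not depend on the ordering.
-- Coordinates are 1-based: j : Fin k constrains intersections and unions of
-- i = suc (toℕ j) members, so Fs is never empty.
IsVille : Vector 𝔽₂∪* k → Vec (Subset n) m → Set
IsVille {k} {n} α 𝓕 =
  ∀ (j : Fin k) →
  Maybe.All
    (λ a → ∀ (Fs : Vec (Subset n) (suc (toℕ j))) → Unique Fs → All (_∈ 𝓕) Fs →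
           parity (∣ ⋂ (toList Fs) ∣ + ∣ ⋃ (toList Fs) ∣) ≡ a)
    (α j)

VilleOfSize : Vector 𝔽₂∪* k → (n m : ℕ) → Set
VilleOfSize α n m = ∃ λ (𝓕 : Vec (Subset n) m) → Unique 𝓕 × IsVille α 𝓕

IsMaximum : (ℕ → Set) → ℕ → Set
IsMaximum P m = P m × (∀ m′ → P m′ → m′ ≤ m)

private
  Searchable : Set → Set₁
  Searchable A = ∀ {P : A → Set} → Decidable P → Dec (∃ P)

  anyVec? : {A : Set} → Searchable A → ∀ m → Searchable (Vec A m)
  anyVec? s zero    P? = map′ ([] ,_) (λ { ([] , p) → p }) (P? [])
  anyVec? s (suc m) P? =
    map′ (λ { (x , xs , p) → (x ∷ xs) , p }) (λ { ((x ∷ xs) , p) → x , xs , p })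
         (s (λ x → anyVec? s m (P? ∘ (x ∷_))))

  every? : {A : Set} → Searchable A → {P : A → Set} → Decidable P → Dec (∀ x → P x)
  every? s P? = map′ (λ ¬∃ x → decidable-stable (P? x) (λ ¬p → ¬∃ (x , ¬p)))
                     (λ ∀p (x , ¬p) → ¬p (∀p x))
                     (¬? (s (¬? ∘ P?)))

  _≟_ : DecidableEquality (Subset n)
  _≟_ = Vec.≡-dec 𝔹._≟_

  unique? : Decidable (Unique {A = Subset n} {m})
  unique? = AllPairs.allPairs? (λ A B → ¬? (A ≟ B))

  isVille? : (α : Vector 𝔽₂∪* k) → Decidable (IsVille {n = n} {m} α)
  isVille? α 𝓕 = all? λ j → Maybe.dec
    (λ a → every? (anyVec? anySubset? _) λ Fs →
      unique? Fs →-dec All.all? (λ F → Any.any? (F ≟_) 𝓕) Fs →-dec (_ ℙ.≟ a))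
    (α j)

  villeOfSize? : (α : Vector 𝔽₂∪* k) (n : ℕ) → Decidable (VilleOfSize α n)
  villeOfSize? α n m = anyVec? anySubset? m (λ 𝓕 → unique? 𝓕 ×-dec isVille? α 𝓕)

  code : Subset n → Fin (2 ^ n)
  code A = funToFin (Inverse.from 2↔Bool ∘ lookup A)

  code-injective : {A B : Subset n} → code A ≡ code B → A ≡ B
  code-injective {A = A} {B} eq = begin
    A                   ≡⟨ Vec.tabulate∘lookup A ⟨
    tabulate (lookup A) ≡⟨ Vec.tabulate-cong pointwise ⟩
    tabulate (lookup B) ≡⟨ Vec.tabulate∘lookup B ⟩
    B                   ∎
    where
    open ≡-Reasoning
    digit : ∀ C i → finToFun (code C) i ≡ Inverse.from 2↔Bool (lookup C i)
    digit C = finToFun-funToFin (Inverse.from 2↔Bool ∘ lookup C)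
    pointwise : ∀ i → lookup A i ≡ lookup B i
    pointwise i = begin
      lookup A i ≡⟨ Inverse.strictlyInverseˡ 2↔Bool _ ⟨
      Inverse.to 2↔Bool (Inverse.from 2↔Bool (lookup A i))
        ≡⟨ cong (Inverse.to 2↔Bool)
             (trans (sym (digit A i)) (trans (cong (λ c → finToFun c i) eq) (digit B i))) ⟩
      Inverse.to 2↔Bool (Inverse.from 2↔Bool (lookup B i))
        ≡⟨ Inverse.strictlyInverseˡ 2↔Bool _ ⟩
      lookup B i ∎

  size≤2^n : (α : Vector 𝔽₂∪* k) (n m : ℕ) → VilleOfSize α n m → m ≤ 2 ^ n
  size≤2^n α n m (𝓕 , 𝓕! , _) =
    injective⇒≤ {f = code ∘ lookup 𝓕} (lookup-injective 𝓕! _ _ ∘ code-injective)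

  allMaybe : {A : Set} {P : A → Set} → (∀ a → P a) → ∀ x → Maybe.All P x
  allMaybe p (just a) = Maybe.just (p a)
  allMaybe p nothing  = Maybe.nothing

  empty : (α : Vector 𝔽₂∪* k) (n : ℕ) → VilleOfSize α n 0
  empty α n = [] , AllPairs.[] , λ j → allMaybe (λ { _ _ _ (() All.∷ _) }) (α j)

  boundedMaximum : {P : ℕ → Set} → Decidable P → P 0 →
                   ∀ b → (∀ m → P m → m ≤ b) → ∃ (IsMaximum P)
  boundedMaximum P? p₀ zero    P≤b = 0 , p₀ , P≤b
  boundedMaximum {P} P? p₀ (suc b) P≤b with P? (suc b)
  ... | yes p = suc b , p , P≤b
  ... | no ¬p = boundedMaximum P? p₀ b λ m pm → below m pm (m≤n⇒m<n∨m≡n (P≤b m pm))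
    where
    below : ∀ m → P m → m < suc b ⊎ m ≡ suc b → m ≤ b
    below m pm (inj₁ m<1+b) = s≤s⁻¹ m<1+b
    below m pm (inj₂ refl)  = contradiction pm ¬p

maximumVille : (α : Vector 𝔽₂∪* k) (n : ℕ) → ∃ (IsMaximum (VilleOfSize α n))
maximumVille α n =
  boundedMaximum (villeOfSize? α n) (empty α n) (2 ^ n) (size≤2^n α n)

g : Vector 𝔽₂∪* k → ℕ → ℕ
g α n = proj₁ (maximumVille α n)

g-isMaximum : (α : Vector 𝔽₂∪* k) (n : ℕ) → IsMaximum (VilleOfSize α n) (g α n)
g-isMaximum α n = proj₂ (maximumVille α n)

-- 1 in the (1-based) ℓ-th coordinate, * elsewhere.
singleOne : (ℓ k : ℕ) → Vector 𝔽₂∪* k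
singleOne ℓ k j = if does (suc (toℕ j) ℕ.≟ ℓ) then just 1ℙ else nothing

{-# OPTIONS --safe #-}

module Submission where

-- |⋂ Fs| + |⋃ Fs| is odd exactly when an odd number of elements lie in some but
-- not all of the sets Fs, so a family is a 0/1 matrix whose columns (the elements)
-- are counted according to whether they split a given ℓ-subset of the rows.
--
-- If ℓ = 2^e, then among 2ℓ − 1 rows a column with d ones splits
-- C(2ℓ−1, ℓ) − C(d, ℓ) − C(2ℓ−1−d, ℓ) ≡ 0 (mod 2) of the ℓ-subsets, whereas the
-- number C(2ℓ−1, ℓ) of all ℓ-subsets is odd. Hence a family has at most 2ℓ − 2 members.
--
-- If ℓ = t·2^v with t > 1 odd, put w = 2^v < ℓ and take all columns with w ones
-- among m rows: each ℓ-subset is split by C(m, w) − C(m − ℓ, w) of them, which is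
-- odd because adding 2^v flips the parity of C(·, 2^v). Here m is arbitrary.

open import Defs
open import Data.Bool.Base using (Bool; true; false; not; _∧_; _∨_)
open import Data.Bool.Properties using (∧-zeroʳ)
open import Data.Fin.Base using (Fin; zero; suc; toℕ; fromℕ<; inject≤)
open import Data.Fin.Properties using (toℕ-fromℕ<; inject≤-injective; suc-injective)
open import Data.Fin.Subset using (Subset; inside; outside; ⊥; ⊤; ∁; ⁅_⁆; _⊆_; ⋂; ⋃; ∣_∣)
open import Data.Fin.Subset.Properties
  using (_⊆?_; ⊥⊆; ⊆⊤; ∣⊥∣≡0; ∣⊤∣≡n; ∣∁p∣≡n∸∣p∣; ∣p∣≤n; p⊆q⇒∣p∣≤∣q∣; x∈⁅x⁆; x∈⁅y⁆⇒x≡y)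
open import Data.List.Base as List using (List; []; _∷_; _++_; length)
open import Data.List.Membership.Propositional using () renaming (_∈_ to _∈ᴸ_)
open import Data.List.Membership.Propositional.Properties using (∈-++⁺ˡ; ∈-tabulate⁺)
import Data.List.Relation.Unary.All as ListAll
import Data.List.Relation.Unary.All.Properties as ListAll
import Data.List.Relation.Unary.Any as ListAny
import Data.List.Relation.Unary.Any.Properties as ListAny
import Data.Maybe.Relation.Unary.All as Maybe
open import Data.Nat.Base
open import Data.Nat.Induction using (<-rec)
open import Data.Nat.Properties hiding (suc-injective)
open import Data.Parity.Base as ℙ using (Parity; 0ℙ; 1ℙ)
import Data.Parity.Properties as ℙ
open import Data.Product.Base using (_×_; _,_; ∃; ∃₂; ∃-syntax; proj₁; proj₂)
open import Data.Vec.Base using (Vec; []; _∷_; lookup; tabulate; toList; map; _[_]≔_)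
open import Data.Vec.Membership.Propositional using (_∈_)
open import Data.Vec.Membership.Propositional.Properties using (∈-lookup)
import Data.Vec.Properties as Vec
open import Data.Vec.Relation.Unary.All as All using (All; []; _∷_)
import Data.Vec.Relation.Unary.All.Properties as All
open import Data.Vec.Relation.Unary.AllPairs using ([]; _∷_)
open import Data.Vec.Relation.Unary.Any.Properties using (tabulate⁻)
open import Data.Vec.Relation.Unary.Unique.Propositional using (Unique)
import Data.Vec.Relation.Unary.Unique.Propositional.Properties as Unique
open import Function.Base using (_∘_)
open import Function.Bundles using (_⇔_; mk⇔)
open import Relation.Binary.PropositionalEquality
open import Relation.Nullary.Decidable using (does; yes; no; dec-true; dec-false)
open import Relation.Nullary.Negation using (¬_; contradiction)
open import Algebra.Properties.CommutativeMonoid.Sum ℙ.+-0-commutativeMonoid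
  using (sum; sum-cong-≗; sum-replicate-zero; ∑-comm; ∑-distrib-+)

open ≡-Reasoning

private
  variable
    A B : Set
    k m n ℓ : ℕ

-- Binomial coefficients modulo 2.

choose : ℕ → ℕ → Parity
choose n       zero    = 1ℙ
choose zero    (suc k) = 0ℙ
choose (suc n) (suc k) = choose n k ℙ.+ choose n (suc k)

choose-zero : n < k → choose n k ≡ 0ℙ
choose-zero {zero}  {suc k} _         = refl
choose-zero {suc n} {suc k} (s≤s n<k) = cong₂ ℙ._+_ (choose-zero n<k) (choose-zero (m<n⇒m<1+n n<k))

-- (1 + x)^(q + n) = (1 + x^q)(1 + x)^n over 𝔽₂, coefficient by coefficient.
Frobenius : ℕ → Set
Frobenius q =
  (∀ n k → k < q → choose (q + n) k ≡ choose n k) ×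
  (∀ n k → choose (q + n) (q + k) ≡ choose n (q + k) ℙ.+ choose n k)

+-cancel-middle : ∀ p q r → (p ℙ.+ q) ℙ.+ (q ℙ.+ r) ≡ p ℙ.+ r
+-cancel-middle p q r = begin
  (p ℙ.+ q) ℙ.+ (q ℙ.+ r) ≡⟨ ℙ.+-assoc p q _ ⟩
  p ℙ.+ (q ℙ.+ (q ℙ.+ r)) ≡⟨ cong (p ℙ.+_) (ℙ.+-assoc q q r) ⟨
  p ℙ.+ (q ℙ.+ q ℙ.+ r)   ≡⟨ cong (λ s → p ℙ.+ (s ℙ.+ r)) (ℙ.p+p≡0ℙ q) ⟩
  p ℙ.+ r                 ∎

frobenius-1 : Frobenius 1
frobenius-1 = (λ { _ zero _ → refl ; _ (suc _) (s≤s ()) }) ,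
              (λ n k → ℙ.+-comm (choose n k) (choose n (suc k)))

-- Multiplying twice by 1 + x^q multiplies by 1 + 2x^q + x^(2q), whose middle term vanishes over 𝔽₂.
frobenius-double : ∀ q → Frobenius q → Frobenius (q + q)
frobenius-double q (low , high) = low′ , high′
  where
  low′ : ∀ n k → k < q + q → choose (q + q + n) k ≡ choose n k
  low′ n k k<2q rewrite +-assoc q q n with k <? q
  ... | yes k<q = trans (low (q + n) k k<q) (low n k k<q)
  -- For q ≤ k < 2q the term `choose n j` arises twice, via `high` from the upper coefficient and
  -- via `low` from the lower one, and cancels.
  ... | no  k≮q with j ← k ∸ q | refl ← m+[n∸m]≡n (≮⇒≥ k≮q) = begin
    choose (q + (q + n)) (q + j)                        ≡⟨ high (q + n) j ⟩
    choose (q + n) (q + j) ℙ.+ choose (q + n) j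
      ≡⟨ cong₂ ℙ._+_ (high n j) (low n j (+-cancelˡ-< q j q k<2q)) ⟩
    choose n (q + j) ℙ.+ choose n j ℙ.+ choose n j      ≡⟨ ℙ.+-assoc (choose n (q + j)) _ _ ⟩
    choose n (q + j) ℙ.+ (choose n j ℙ.+ choose n j)
      ≡⟨ cong (choose n (q + j) ℙ.+_) (ℙ.p+p≡0ℙ (choose n j)) ⟩
    choose n (q + j) ℙ.+ 0ℙ                             ≡⟨ ℙ.+-identityʳ _ ⟩
    choose n (q + j)                                    ∎

  high′ : ∀ n k → choose (q + q + n) (q + q + k) ≡ choose n (q + q + k) ℙ.+ choose n k
  high′ n k rewrite +-assoc q q n | +-assoc q q k = begin
    choose (q + (q + n)) (q + (q + k))                  ≡⟨ high (q + n) (q + k) ⟩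
    choose (q + n) (q + (q + k)) ℙ.+ choose (q + n) (q + k)
      ≡⟨ cong₂ ℙ._+_ (high n (q + k)) (high n k) ⟩
    _ ≡⟨ +-cancel-middle (choose n (q + (q + k))) (choose n (q + k)) (choose n k) ⟩
    choose n (q + (q + k)) ℙ.+ choose n k               ∎

frobenius-2^ : ∀ v → Frobenius (2 ^ v)
frobenius-2^ zero = frobenius-1
frobenius-2^ (suc v) =
  subst (λ q → Frobenius (2 ^ v + q)) (sym (+-identityʳ (2 ^ v)))
    (frobenius-double (2 ^ v) (frobenius-2^ v))

-- This is the coefficient of x^q in (1 + x^q)(1 + x)^n; the constant term of (1 + x)^n supplies the
-- `1ℙ`.
choose-step : ∀ {q} → Frobenius q → ∀ n → choose (q + n) q ≡ choose n q ℙ.+ 1ℙ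
choose-step {q} (_ , high) n with high n 0
... | eq rewrite +-identityʳ q = eq

choose-multiple : ∀ {q} → Frobenius q → ∀ t n →
                  choose (t * q + n) q ≡ choose n q ℙ.+ parity t
choose-multiple fr zero    n = sym (ℙ.+-identityʳ _)
choose-multiple {q} fr (suc t) n = begin
  choose (q + t * q + n) q            ≡⟨ cong (λ s → choose s q) (+-assoc q (t * q) n) ⟩
  choose (q + (t * q + n)) q          ≡⟨ choose-step fr (t * q + n) ⟩
  choose (t * q + n) q ℙ.+ 1ℙ         ≡⟨ cong (ℙ._+ 1ℙ) (choose-multiple fr t n) ⟩
  choose n q ℙ.+ parity t ℙ.+ 1ℙ      ≡⟨ ℙ.+-assoc (choose n q) _ _ ⟩
  choose n q ℙ.+ (parity t ℙ.+ 1ℙ)    ≡⟨ cong (choose n q ℙ.+_) (ℙ.+-comm (parity t) 1ℙ) ⟩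
  choose n q ℙ.+ (1ℙ ℙ.+ parity t)    ≡⟨ cong (choose n q ℙ.+_) (ℙ.+-homo-+ 1 t) ⟨
  choose n q ℙ.+ parity (suc t)       ∎

-- Write q = `suc r` and d = q + n. Then n + d′ = r < q, so C(n, q) and C(d′, q) vanish and only the
-- 1 from `choose-step` is left.
choose-large : ∀ {r} → Frobenius (suc r) → ∀ d d′ → suc r ≤ d → d + d′ ≡ suc r + r →
               choose d (suc r) ℙ.+ choose d′ (suc r) ≡ 1ℙ
choose-large {r} fr d d′ q≤d eq with n ← d ∸ suc r | refl ← m+[n∸m]≡n q≤d = begin
  choose (suc r + n) (suc r) ℙ.+ choose d′ (suc r)
    ≡⟨ cong₂ ℙ._+_ (choose-step fr n) (choose-zero (s≤s (m+n≤o⇒n≤o n n+d′≤r))) ⟩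
  choose n (suc r) ℙ.+ 1ℙ ℙ.+ 0ℙ
    ≡⟨ cong (λ p → p ℙ.+ 1ℙ ℙ.+ 0ℙ) (choose-zero (s≤s (m+n≤o⇒m≤o n n+d′≤r))) ⟩
  1ℙ ∎
  where
  n+d′≤r : n + d′ ≤ r
  n+d′≤r = ≤-reflexive (+-cancelˡ-≡ (suc r) _ _ (trans (sym (+-assoc (suc r) n d′)) eq))

-- Of two numbers with sum 2q - 1, where q = `suc r`, exactly one is at least q. In the upper bound
-- they are the numbers of ones and zeros in a column.
choose-split : ∀ {r} → Frobenius (suc r) → ∀ d d′ → d + d′ ≡ suc r + r →
               choose d (suc r) ℙ.+ choose d′ (suc r) ≡ 1ℙ
choose-split {r} fr d d′ eq with suc r ≤? d | suc r ≤? d′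
... | yes q≤d | _        = choose-large fr d d′ q≤d eq
... | no _    | yes q≤d′ =
  trans (ℙ.+-comm (choose d (suc r)) _) (choose-large fr d′ d q≤d′ (trans (+-comm d′ d) eq))
... | no q≰d  | no q≰d′  =
  contradiction eq (<⇒≢ (+-mono-<-≤ (≰⇒> q≰d) (s≤s⁻¹ (≰⇒> q≰d′))))

-- Containment and splitting of subsets modulo 2.

indicator : Bool → Parity
indicator true  = 1ℙ
indicator false = 0ℙ

indicator-not : ∀ b → indicator (not b) ≡ 1ℙ ℙ.+ indicator b
indicator-not true  = refl
indicator-not false = refl

∨-not : ∀ a b → a ∨ not b ≡ not (not a ∧ b)
∨-not true  b = refl
∨-not false b = refl

contained : Subset m → Subset m → Parity
contained p q = indicator (does (p ⊆? q))

-- The parity of the incidences of an element with ∩ and ∪ of the sets indexed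
-- by p, when the element lies in exactly the sets indexed by q.
split : Subset m → Subset m → Parity
split p q = 1ℙ ℙ.+ (contained p q ℙ.+ contained p (∁ q))

-- Both sides say that p and q are disjoint. The swap puts the varying set on the left, where
-- `sum-contained` counts it.
contained-∁ : (p q : Subset m) → contained p (∁ q) ≡ contained q (∁ p)
contained-∁ []            []            = refl
contained-∁ (outside ∷ p) (outside ∷ q) = contained-∁ p q
contained-∁ (outside ∷ p) (inside  ∷ q) = contained-∁ p q
contained-∁ (inside  ∷ p) (outside ∷ q) = contained-∁ p q
contained-∁ (inside  ∷ p) (inside  ∷ q) = refl

contained-true : {p q : Subset m} → p ⊆ q → contained p q ≡ 1ℙ
contained-true p⊆q = cong indicator (dec-true (_ ⊆? _) p⊆q)

contained-false : (p q : Subset m) → ∣ q ∣ < ∣ p ∣ → contained p q ≡ 0ℙ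
contained-false p q q<p = cong indicator (dec-false (p ⊆? q) (<⇒≱ q<p ∘ p⊆q⇒∣p∣≤∣q∣))

∣p∣+∣∁p∣≡n : (p : Subset n) → ∣ p ∣ + ∣ ∁ p ∣ ≡ n
∣p∣+∣∁p∣≡n p = trans (cong (∣ p ∣ +_) (∣∁p∣≡n∸∣p∣ p)) (m+[n∸m]≡n (∣p∣≤n p))

parity-∣∣ : (p : Subset n) → parity ∣ p ∣ ≡ sum (indicator ∘ lookup p)
parity-∣∣ []            = refl
parity-∣∣ (inside  ∷ p) = trans (ℙ.+-homo-+ 1 ∣ p ∣) (cong (1ℙ ℙ.+_) (parity-∣∣ p))
parity-∣∣ (outside ∷ p) = parity-∣∣ p

-- Index sets, columns, and the passage from sizes to splits.

support : Vec (Fin m) k → Subset m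
support []       = ⊥
support (i ∷ is) = support is [ i ]≔ inside

-- One more index adds one conjunct, just as one more set does in `⋂`; hence the Boolean form.
does-insert : (p q : Subset m) (i : Fin m) →
              does (p [ i ]≔ inside ⊆? q) ≡ lookup q i ∧ does (p ⊆? q)
does-insert (inside  ∷ p) (inside  ∷ q) zero    = refl
does-insert (inside  ∷ p) (outside ∷ q) zero    = refl
does-insert (outside ∷ p) (inside  ∷ q) zero    = refl
does-insert (outside ∷ p) (outside ∷ q) zero    = refl
does-insert (inside  ∷ p) (inside  ∷ q) (suc i) = does-insert p q i
does-insert (inside  ∷ p) (outside ∷ q) (suc i) = sym (∧-zeroʳ (lookup q i))
does-insert (outside ∷ p) (_       ∷ q) (suc i) = does-insert p q i

size-insert : (p : Subset m) (i : Fin m) → lookup p i ≡ outside →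
              ∣ p [ i ]≔ inside ∣ ≡ suc ∣ p ∣
size-insert (outside ∷ p) zero    _  = refl
size-insert (inside  ∷ p) (suc i) eq = cong suc (size-insert p i eq)
size-insert (outside ∷ p) (suc i) eq = size-insert p i eq

lookup-support : {is : Vec (Fin m) k} (i : Fin m) → All (i ≢_) is →
                 lookup (support is) i ≡ outside
lookup-support i []           = Vec.lookup-replicate i outside
lookup-support {is = _ ∷ is} i (i≢j ∷ i∉is) =
  trans (Vec.lookup∘update′ i≢j (support is) inside) (lookup-support i i∉is)

size-support : {is : Vec (Fin m) k} → Unique is → ∣ support is ∣ ≡ k
size-support {m} {is = []}     []         = ∣⊥∣≡0 m
size-support     {is = i ∷ is} (i∉is ∷ u) =
  trans (size-insert (support is) i (lookup-support i i∉is)) (cong suc (size-support u))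

support-map-suc : (is : Vec (Fin m) k) → support (map suc is) ≡ outside ∷ support is
support-map-suc []       = refl
support-map-suc (i ∷ is) rewrite support-map-suc is = refl

column : (Fin m → Subset n) → Fin n → Subset m
column 𝓕 x = tabulate (λ i → lookup (𝓕 i) x)

lookup-⋂ : (𝓕 : Fin m → Subset n) (is : Vec (Fin m) k) (x : Fin n) →
           lookup (⋂ (toList (map 𝓕 is))) x ≡ does (support is ⊆? column 𝓕 x)
lookup-⋂ 𝓕 []       x = trans (Vec.lookup-replicate x inside)
  (sym (dec-true (⊥ ⊆? column 𝓕 x) (⊥⊆ {p = column 𝓕 x})))
lookup-⋂ 𝓕 (i ∷ is) x = begin
  lookup (⋂ (toList (map 𝓕 (i ∷ is)))) x
    ≡⟨ Vec.lookup-zipWith _∧_ x (𝓕 i) _ ⟩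
  lookup (𝓕 i) x ∧ lookup (⋂ (toList (map 𝓕 is))) x
    ≡⟨ cong₂ _∧_ (sym (Vec.lookup∘tabulate _ i)) (lookup-⋂ 𝓕 is x) ⟩
  lookup (column 𝓕 x) i ∧ does (support is ⊆? column 𝓕 x)
    ≡⟨ does-insert (support is) (column 𝓕 x) i ⟨
  does (support (i ∷ is) ⊆? column 𝓕 x) ∎

-- De Morgan: x misses the union exactly when all the chosen rows are zeros of its column.
lookup-⋃ : (𝓕 : Fin m → Subset n) (is : Vec (Fin m) k) (x : Fin n) →
           lookup (⋃ (toList (map 𝓕 is))) x ≡ not (does (support is ⊆? ∁ (column 𝓕 x)))
lookup-⋃ 𝓕 []       x = trans (Vec.lookup-replicate x outside)
  (cong not (sym (dec-true (⊥ ⊆? ∁ (column 𝓕 x)) (⊥⊆ {p = ∁ (column 𝓕 x)}))))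
lookup-⋃ 𝓕 (i ∷ is) x = begin
  lookup (⋃ (toList (map 𝓕 (i ∷ is)))) x
    ≡⟨ Vec.lookup-zipWith _∨_ x (𝓕 i) _ ⟩
  lookup (𝓕 i) x ∨ lookup (⋃ (toList (map 𝓕 is))) x
    ≡⟨ cong₂ _∨_ (sym (Vec.lookup∘tabulate _ i)) (lookup-⋃ 𝓕 is x) ⟩
  lookup (column 𝓕 x) i ∨ not d
    ≡⟨ ∨-not (lookup (column 𝓕 x) i) d ⟩
  not (not (lookup (column 𝓕 x) i) ∧ d)
    ≡⟨ cong (λ b → not (b ∧ d)) (Vec.lookup-map i not (column 𝓕 x)) ⟨
  not (lookup (∁ (column 𝓕 x)) i ∧ d)
    ≡⟨ cong not (does-insert (support is) (∁ (column 𝓕 x)) i) ⟨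
  not (does (support (i ∷ is) ⊆? ∁ (column 𝓕 x))) ∎
  where
  d = does (support is ⊆? ∁ (column 𝓕 x))

-- Both sizes are counted element by element, and what an element contributes depends on its column
-- alone.
parity-split : (𝓕 : Fin m → Subset n) (is : Vec (Fin m) k) →
               parity (∣ ⋂ (toList (map 𝓕 is)) ∣ + ∣ ⋃ (toList (map 𝓕 is)) ∣) ≡
               sum (λ x → split (support is) (column 𝓕 x))
parity-split 𝓕 is = begin
  parity (∣ P ∣ + ∣ Q ∣)           ≡⟨ ℙ.+-homo-+ ∣ P ∣ ∣ Q ∣ ⟩
  parity ∣ P ∣ ℙ.+ parity ∣ Q ∣    ≡⟨ cong₂ ℙ._+_ (parity-∣∣ P) (parity-∣∣ Q) ⟩
  sum (indicator ∘ lookup P) ℙ.+ sum (indicator ∘ lookup Q)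
    ≡⟨ ∑-distrib-+ (indicator ∘ lookup P) (indicator ∘ lookup Q) ⟨
  sum (λ x → indicator (lookup P x) ℙ.+ indicator (lookup Q x))
    ≡⟨ sum-cong-≗ pointwise ⟩
  sum (λ x → split (support is) (column 𝓕 x)) ∎
  where
  P = ⋂ (toList (map 𝓕 is))
  Q = ⋃ (toList (map 𝓕 is))
  pointwise : ∀ x → indicator (lookup P x) ℙ.+ indicator (lookup Q x) ≡
                    split (support is) (column 𝓕 x)
  -- The negation coming from the union supplies the leading `1ℙ` of `split`.
  pointwise x rewrite lookup-⋂ 𝓕 is x | lookup-⋃ 𝓕 is x
                    | indicator-not (does (support is ⊆? ∁ (column 𝓕 x))) =
    trans (sym (ℙ.+-assoc p 1ℙ q)) (trans (cong (ℙ._+ q) (ℙ.+-comm p 1ℙ)) (ℙ.+-assoc 1ℙ p q))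
    where
    p = contained (support is) (column 𝓕 x)
    q = contained (support is) (∁ (column 𝓕 x))

-- Sums over the k-subsets of the rows.

sumOver : List A → (A → Parity) → Parity
-- Summing over positions makes `∑-comm` and `∑-distrib-+` applicable to lists.
sumOver xs f = sum (f ∘ List.lookup xs)

sumOver-++ : (xs ys : List A) (f : A → Parity) →
             sumOver (xs ++ ys) f ≡ sumOver xs f ℙ.+ sumOver ys f
sumOver-++ []       ys f = refl
sumOver-++ (x ∷ xs) ys f =
  trans (cong (f x ℙ.+_) (sumOver-++ xs ys f)) (sym (ℙ.+-assoc (f x) _ _))

sumOver-map : (h : A → B) (xs : List A) (f : B → Parity) →
              sumOver (List.map h xs) f ≡ sumOver xs (f ∘ h)
sumOver-map h []       f = refl
sumOver-map h (x ∷ xs) f = cong (f (h x) ℙ.+_) (sumOver-map h xs f)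

sumOver-cong : {xs : List A} {f g : A → Parity} → ListAll.All (λ x → f x ≡ g x) xs →
               sumOver xs f ≡ sumOver xs g
sumOver-cong ListAll.[]         = refl
sumOver-cong (eq ListAll.∷ eqs) = cong₂ ℙ._+_ eq (sumOver-cong eqs)

sumOver-0 : (xs : List A) → sumOver xs (λ _ → 0ℙ) ≡ 0ℙ
sumOver-0 []       = refl
sumOver-0 (x ∷ xs) = sumOver-0 xs

-- The k-subsets of `Fin m` as increasing vectors, those through `zero` first.
combinations : ∀ m k → List (Vec (Fin m) k)
combinations m       zero    = List.[ [] ]
combinations zero    (suc k) = []
combinations (suc m) (suc k) =
  List.map (λ is → zero ∷ map suc is) (combinations m k) ++
  List.map (map suc) (combinations m (suc k))

combinations-unique : ∀ m k → ListAll.All Unique (combinations m k)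
combinations-unique m       zero    = [] ListAll.∷ ListAll.[]
combinations-unique zero    (suc k) = ListAll.[]
combinations-unique (suc m) (suc k) = ListAll.++⁺
  (ListAll.map⁺ (ListAll.map
    (λ u → All.map⁺ (All.universal (λ _ ()) _) ∷ Unique.map⁺ suc-injective u)
    (combinations-unique m k)))
  (ListAll.map⁺ (ListAll.map (Unique.map⁺ suc-injective) (combinations-unique m (suc k))))

-- Pascal's rule: the k-subsets of q are sorted by whether they contain the first row.
sum-contained : ∀ m k (q : Subset m) →
                sumOver (combinations m k) (λ is → contained (support is) q) ≡ choose ∣ q ∣ k
sum-contained m       zero    q  =
  trans (ℙ.+-identityʳ _) (contained-true (⊥⊆ {p = q}))
sum-contained zero    (suc k) [] = refl
sum-contained (suc m) (suc k) (x ∷ q) = begin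
  sumOver (combinations (suc m) (suc k)) f
    ≡⟨ sumOver-++ (List.map (λ is → zero ∷ map suc is) (combinations m k)) _ f ⟩
  sumOver (List.map (λ is → zero ∷ map suc is) (combinations m k)) f ℙ.+
  sumOver (List.map (map suc) (combinations m (suc k))) f
    ≡⟨ cong₂ ℙ._+_ (sumOver-map _ (combinations m k) f)
                   (sumOver-map _ (combinations m (suc k)) f) ⟩
  sumOver (combinations m k) (λ is → f (zero ∷ map suc is)) ℙ.+
  sumOver (combinations m (suc k)) (f ∘ map suc)
    ≡⟨ cong₂ ℙ._+_ (sum-cong-≗ (λ i → with-zero (List.lookup (combinations m k) i)))
                   (sum-cong-≗ (λ i → without-zero (List.lookup (combinations m (suc k)) i))) ⟩
  sumOver (combinations m k) (λ is → contained (inside ∷ support is) (x ∷ q)) ℙ.+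
  sumOver (combinations m (suc k)) (λ is → contained (support is) q)
    ≡⟨ pascal x ⟩
  choose ∣ x ∷ q ∣ (suc k) ∎
  where
  f : Vec (Fin (suc m)) (suc k) → Parity
  f is = contained (support is) (x ∷ q)
  with-zero : ∀ is → f (zero ∷ map suc is) ≡ contained (inside ∷ support is) (x ∷ q)
  with-zero is rewrite support-map-suc is = refl
  without-zero : ∀ is → f (map suc is) ≡ contained (support is) q
  without-zero is rewrite support-map-suc is = refl
  pascal : ∀ x → sumOver (combinations m k) (λ is → contained (inside ∷ support is) (x ∷ q)) ℙ.+
                 sumOver (combinations m (suc k)) (λ is → contained (support is) q) ≡
                 choose ∣ x ∷ q ∣ (suc k)
  pascal inside  = cong₂ ℙ._+_ (sum-contained m k q) (sum-contained m (suc k) q)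
  -- With the first row outside q, no combination through `zero` is contained in q.
  pascal outside = cong₂ ℙ._+_ (sumOver-0 (combinations m k)) (sum-contained m (suc k) q)

-- Every k-subset lies in `⊤`, so the count is `sum-contained` for the full set.
sum-1 : ∀ m k → sumOver (combinations m k) (λ _ → 1ℙ) ≡ choose m k
sum-1 m k = begin
  sumOver (combinations m k) (λ _ → 1ℙ)
    ≡⟨ sum-cong-≗ (λ i → contained-true (⊆⊤ {p = support (List.lookup (combinations m k) i)})) ⟨
  sumOver (combinations m k) (λ is → contained (support is) ⊤)
    ≡⟨ sum-contained m k ⊤ ⟩
  choose ∣ ⊤ {n = m} ∣ k
    ≡⟨ cong (λ n → choose n k) (∣⊤∣≡n m) ⟩
  choose m k ∎

sum-split : (xs : List A) (p q : A → Subset m) →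
            sumOver xs (λ x → split (p x) (q x)) ≡
            sumOver xs (λ _ → 1ℙ) ℙ.+
            (sumOver xs (λ x → contained (p x) (q x)) ℙ.+
             sumOver xs (λ x → contained (p x) (∁ (q x))))
sum-split xs p q =
  trans (∑-distrib-+ (λ _ → 1ℙ) (λ i → P (at i) ℙ.+ Q (at i)))
    (cong (sumOver xs (λ _ → 1ℙ) ℙ.+_) (∑-distrib-+ (P ∘ at) (Q ∘ at)))
  where
  at = List.lookup xs
  P = λ x → contained (p x) (q x)
  Q = λ x → contained (p x) (∁ (q x))

-- Upper bound by double counting.

OddlySplit : ℕ → (Fin m → Subset n) → Set
OddlySplit {m} ℓ 𝓕 =
  (is : Vec (Fin m) ℓ) → Unique is →
  parity (∣ ⋂ (toList (map 𝓕 is)) ∣ + ∣ ⋃ (toList (map 𝓕 is)) ∣) ≡ 1ℙ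

¬oddlySplit : ∀ {r} → Frobenius (suc r) → (𝓕 : Fin (suc r + r) → Subset n) →
              ¬ OddlySplit (suc r) 𝓕
¬oddlySplit {n} {r} fr 𝓕 odd = contradiction 1≡0 λ ()
  where
  q M : ℕ
  q = suc r
  M = q + r
  cs = combinations M q
  choose-M : choose M q ≡ 1ℙ
  -- The decomposition M = M + 0, whose second coefficient computes to `0ℙ`.
  choose-M = trans (sym (ℙ.+-identityʳ _)) (choose-split fr M 0 (+-identityʳ M))
  per-column : ∀ x → sumOver cs (λ is → split (support is) (column 𝓕 x)) ≡ 0ℙ
  per-column x = begin
    sumOver cs (λ is → split (support is) c)
      ≡⟨ sum-split cs support (λ _ → c) ⟩
    _ ≡⟨ cong₂ ℙ._+_ (sum-1 M q) (cong₂ ℙ._+_ (sum-contained M q c) (sum-contained M q (∁ c))) ⟩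
    choose M q ℙ.+ ((choose ∣ c ∣ q) ℙ.+ (choose ∣ ∁ c ∣ q))
      -- The ones and zeros of the column add up to M, so the bracket is `1ℙ` too, and 1 + 1 = 0.
      ≡⟨ cong₂ ℙ._+_ choose-M (choose-split fr ∣ c ∣ ∣ ∁ c ∣ (∣p∣+∣∁p∣≡n c)) ⟩
    0ℙ ∎
    where c = column 𝓕 x
  1≡0 : 1ℙ ≡ 0ℙ
  1≡0 = begin
    1ℙ                                       ≡⟨ choose-M ⟨
    choose M q                               ≡⟨ sum-1 M q ⟨
    sumOver cs (λ _ → 1ℙ)
      ≡⟨ sumOver-cong (ListAll.map (λ {is} u → trans (sym (odd is u)) (parity-split 𝓕 is))
           (combinations-unique M q)) ⟩
    sumOver cs (λ is → sum (λ x → split (support is) (column 𝓕 x)))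
      -- Exchanging the sums turns the count by row subsets into the count by columns.
      ≡⟨ ∑-comm (λ i x → split (support (List.lookup cs i)) (column 𝓕 x)) ⟩
    sum (λ x → sumOver cs (λ is → split (support is) (column 𝓕 x)))
      ≡⟨ sum-cong-≗ per-column ⟩
    sum {n} (λ _ → 0ℙ)                       ≡⟨ sum-replicate-zero n ⟩
    0ℙ ∎

-- Construction of arbitrarily large families.

fromColumns : (cs : List (Subset m)) → Fin m → Subset (length cs)
fromColumns cs i = tabulate (λ x → lookup (List.lookup cs x) i)

column-fromColumns : (cs : List (Subset m)) (x : Fin (length cs)) →
                     column (fromColumns cs) x ≡ List.lookup cs x
column-fromColumns cs x =
  trans (Vec.tabulate-cong (λ i → Vec.lookup∘tabulate _ x)) (Vec.tabulate∘lookup (List.lookup cs x))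

lookup-fromColumns : (cs : List (Subset m)) {i j : Fin m} → fromColumns cs i ≡ fromColumns cs j →
                     {c : Subset m} → c ∈ᴸ cs → lookup c i ≡ lookup c j
lookup-fromColumns cs {i} {j} eq {c} c∈cs = begin
  lookup c i                        ≡⟨ cong (λ c → lookup c i) (ListAny.lookup-index c∈cs) ⟩
  lookup (List.lookup cs x) i       ≡⟨ Vec.lookup∘tabulate _ x ⟨
  lookup (fromColumns cs i) x       ≡⟨ cong (λ F → lookup F x) eq ⟩
  lookup (fromColumns cs j) x       ≡⟨ Vec.lookup∘tabulate _ x ⟩
  lookup (List.lookup cs x) j       ≡⟨ cong (λ c → lookup c j) (ListAny.lookup-index c∈cs) ⟨
  lookup c j                        ∎
  where x = ListAny.index c∈cs

-- The singletons make the rows distinct; occurring twice, they do not affect parities.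
columns : ∀ m → ℕ → List (Subset m)
columns m w = singletons ++ singletons ++ List.map support (combinations m w)
  where singletons = List.tabulate ⁅_⁆

-- The column `⁅ i ⁆` has its only one in row i, so a row equal to row i must be row i itself.
fromColumns-injective : ∀ {m} w {i j : Fin m} →
                        fromColumns (columns m w) i ≡ fromColumns (columns m w) j → i ≡ j
fromColumns-injective {m} w {i} {j} eq = sym (x∈⁅y⁆⇒x≡y i (Vec.lookup⇒[]= j ⁅ i ⁆ (begin
  lookup ⁅ i ⁆ j  ≡⟨ lookup-fromColumns (columns m w) eq (∈-++⁺ˡ (∈-tabulate⁺ i)) ⟨
  lookup ⁅ i ⁆ i  ≡⟨ Vec.[]=⇒lookup (x∈⁅x⁆ i) ⟩
  inside          ∎)))

-- Since w < ℓ, a column with w ones cannot contain the ℓ-subset; it fails to split it only by lying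
-- in the complement, which has m - ℓ rows. Then `shift` compares C(m, w) with C(m - ℓ, w).
fromColumns-oddlySplit : ∀ m w ℓ → w < ℓ → (∀ n → choose (ℓ + n) w ≡ choose n w ℙ.+ 1ℙ) →
                         OddlySplit ℓ (fromColumns (columns m w))
fromColumns-oddlySplit m w ℓ w<ℓ shift is u = begin
  _ ≡⟨ parity-split (fromColumns (columns m w)) is ⟩
  sum (λ x → split p (column (fromColumns (columns m w)) x))
    ≡⟨ sum-cong-≗ (λ x → cong (split p) (column-fromColumns (columns m w) x)) ⟩
  sumOver (columns m w) (split p)
    ≡⟨ sumOver-++ singletons _ (split p) ⟩
  s ℙ.+ sumOver (singletons ++ List.map support cs) (split p)
    ≡⟨ cong (s ℙ.+_) (sumOver-++ singletons _ (split p)) ⟩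
  s ℙ.+ (s ℙ.+ sumOver (List.map support cs) (split p))
    ≡⟨ ℙ.+-assoc s s _ ⟨
  s ℙ.+ s ℙ.+ sumOver (List.map support cs) (split p)
    ≡⟨ cong₂ ℙ._+_ (ℙ.p+p≡0ℙ s) (sumOver-map support cs (split p)) ⟩
  sumOver cs (split p ∘ support)
    ≡⟨ sum-split cs (λ _ → p) support ⟩
  sumOver cs (λ _ → 1ℙ) ℙ.+
  (sumOver cs (contained p ∘ support) ℙ.+ sumOver cs (λ js → contained p (∁ (support js))))
    ≡⟨ cong₂ ℙ._+_ (sum-1 m w) (cong₂ ℙ._+_ none disjoint) ⟩
  choose m w ℙ.+ b
    -- Writing m as ℓ + (m - ℓ) brings it into the form of `shift`.
    ≡⟨ cong (λ n → choose n w ℙ.+ b) m≡ ⟨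
  choose (ℓ + ∣ ∁ p ∣) w ℙ.+ b
    ≡⟨ cong (ℙ._+ b) (shift ∣ ∁ p ∣) ⟩
  b ℙ.+ 1ℙ ℙ.+ b
    ≡⟨ cong (ℙ._+ b) (ℙ.+-comm b 1ℙ) ⟩
  1ℙ ℙ.+ b ℙ.+ b
    ≡⟨ ℙ.+-assoc 1ℙ b _ ⟩
  1ℙ ℙ.+ (b ℙ.+ b)
    ≡⟨ cong (1ℙ ℙ.+_) (ℙ.p+p≡0ℙ b) ⟩
  1ℙ ∎
  where
  p = support is
  cs = combinations m w
  b = choose ∣ ∁ p ∣ w
  singletons : List (Subset m)
  singletons = List.tabulate ⁅_⁆
  s = sumOver singletons (split p)
  m≡ : ℓ + ∣ ∁ p ∣ ≡ m
  m≡ = trans (cong (_+ ∣ ∁ p ∣) (sym (size-support u))) (∣p∣+∣∁p∣≡n p)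
  none : sumOver cs (contained p ∘ support) ≡ 0ℙ
  none = trans
    (sumOver-cong (ListAll.map
      (λ {js} v → contained-false p (support js)
        (subst₂ _<_ (sym (size-support v)) (sym (size-support u)) w<ℓ))
      (combinations-unique m w)))
    (sumOver-0 cs)
  disjoint : sumOver cs (λ js → contained p (∁ (support js))) ≡ b
  disjoint = trans
    (sum-cong-≗ (λ i → contained-∁ p (support (List.lookup cs i))))
    (sum-contained m w (∁ p))

-- Translation between villes and indexed families.

ville⇒oddlySplit : (j : Fin k) → suc (toℕ j) ≡ ℓ → VilleOfSize (singleOne ℓ k) n m →
                   ∃ λ (𝓕 : Fin m → Subset n) → OddlySplit ℓ 𝓕
ville⇒oddlySplit j refl (𝓕 , u , ville) with ville j
-- Evaluating the test in `singleOne` at j exposes the constraint as a `just`.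
... | v rewrite dec-true (suc (toℕ j) ≟ suc (toℕ j)) refl with Maybe.just odd ← v =
  lookup 𝓕 , λ is is! → odd (map (lookup 𝓕) is)
    (Unique.map⁺ (Unique.lookup-injective u _ _) is!)
    (All.map⁺ (All.universal (λ i → ∈-lookup i 𝓕) is))

-- Recovers row indices from members, since `OddlySplit` speaks of indices and `IsVille` of sets.
unmap : (𝓕 : Fin m → A) {Fs : Vec A k} → All (_∈ tabulate 𝓕) Fs → ∃ λ is → map 𝓕 is ≡ Fs
unmap 𝓕 []               = [] , refl
unmap 𝓕 (F∈𝓕 ∷ Fs∈𝓕) with is , eq ← unmap 𝓕 Fs∈𝓕 | i , refl ← tabulate⁻ F∈𝓕 =
  i ∷ is , cong (𝓕 i ∷_) eq

map-unique⁻ : (f : A → B) {xs : Vec A k} → Unique (map f xs) → Unique xs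
map-unique⁻ f {[]}     []        = []
map-unique⁻ f {x ∷ xs} (x∉ ∷ u) =
  All.map (λ fx≢fy → fx≢fy ∘ cong f) (All.map⁻ x∉) ∷ map-unique⁻ f u

oddlySplit⇒ville : {𝓕 : Fin m → Subset n} → (∀ {i j} → 𝓕 i ≡ 𝓕 j → i ≡ j) →
                   OddlySplit ℓ 𝓕 → VilleOfSize (singleOne ℓ k) n m
oddlySplit⇒ville {𝓕 = 𝓕} inj odd =
  tabulate 𝓕 , Unique.tabulate⁺ inj , λ j → coordinate j odd
  where
  odd-members : OddlySplit ℓ 𝓕 → ∀ {Fs : Vec _ ℓ} → Unique Fs → (∃ λ is → map 𝓕 is ≡ Fs) →
                parity (∣ ⋂ (toList Fs) ∣ + ∣ ⋃ (toList Fs) ∣) ≡ 1ℙ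
  odd-members odd Fs! (is , refl) = odd is (map-unique⁻ 𝓕 Fs!)
  -- Here ℓ is generalised afresh, with the oddness hypothesis as an argument, so that matching
  -- `refl` can replace it by `suc (toℕ j)`.
  coordinate : (j : Fin k) → OddlySplit ℓ 𝓕 →
               Maybe.All
                 (λ a → ∀ (Fs : Vec _ (suc (toℕ j))) → Unique Fs → All (_∈ tabulate 𝓕) Fs →
                        parity (∣ ⋂ (toList Fs) ∣ + ∣ ⋃ (toList Fs) ∣) ≡ a)
                 (singleOne ℓ k j)
  coordinate {ℓ = ℓ} j odd with suc (toℕ j) ≟ ℓ
  ... | no  j≢ℓ rewrite dec-false (suc (toℕ j) ≟ ℓ) j≢ℓ = Maybe.nothing
  ... | yes refl rewrite dec-true (suc (toℕ j) ≟ suc (toℕ j)) refl =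
    Maybe.just λ Fs Fs! Fs∈𝓕 → odd-members odd Fs! (unmap 𝓕 Fs∈𝓕)

-- Cuts an oversized family down to exactly the number of rows at which `¬oddlySplit` applies.
oddlySplit-inject≤ : {𝓕 : Fin m → Subset n} (k≤m : k ≤ m) → OddlySplit ℓ 𝓕 →
                     OddlySplit ℓ (λ i → 𝓕 (inject≤ i k≤m))
oddlySplit-inject≤ {𝓕 = 𝓕} k≤m odd is is!
  rewrite Vec.map-∘ 𝓕 (λ i → inject≤ i k≤m) is =
  odd (map (λ i → inject≤ i k≤m) is) (Unique.map⁺ (inject≤-injective k≤m k≤m _ _) is!)

-- Odd parts and the two implications.

even-half : ∀ n → parity n ≡ 0ℙ → ∃[ h ] n ≡ 2 * h
even-half zero          _    = 0 , refl
even-half (suc (suc n)) even with h , refl ← even-half n even =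
  suc h , cong suc (sym (+-suc h (h + 0)))

odd-part : ∀ n → 0 < n → ∃₂ λ v t → parity t ≡ 1ℙ × n ≡ t * 2 ^ v
odd-part = <-rec _ step
  where
  step : ∀ n → (∀ {h} → h < n → 0 < h → ∃₂ λ v t → parity t ≡ 1ℙ × h ≡ t * 2 ^ v) →
         0 < n → ∃₂ λ v t → parity t ≡ 1ℙ × n ≡ t * 2 ^ v
  step n rec 0<n with parity n in eq
  ... | 1ℙ = 0 , n , eq , sym (*-identityʳ n)
  ... | 0ℙ with even-half n eq
  -- Half zero would contradict `0<n`; a positive half is smaller than n, so the recursion applies.
  ...   | suc h , refl with v , t , odd , h≡ ← rec (s≤s (m<m+n h (s≤s z≤n))) (s≤s z≤n) =
    suc v , t , odd , (begin
      2 * suc h         ≡⟨ cong (2 *_) h≡ ⟩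
      2 * (t * 2 ^ v)   ≡⟨ *-assoc 2 t (2 ^ v) ⟨
      2 * t * 2 ^ v     ≡⟨ cong (_* 2 ^ v) (*-comm 2 t) ⟩
      t * 2 * 2 ^ v     ≡⟨ *-assoc t 2 (2 ^ v) ⟩
      t * 2 ^ suc v     ∎)

-- Parity rules out t = 0. Any odd t other than 1 gives w = 2^v < ℓ, hence a family of `suc C` sets,
-- against the bound C.
bounded⇒power : ∀ ℓ k → 0 < ℓ → (∃[ C ] ∀ n → 1 ≤ n → g (singleOne ℓ k) n ≤ C) → ∃[ e ] ℓ ≡ 2 ^ e
bounded⇒power ℓ k 0<ℓ (C , g≤C) with odd-part ℓ 0<ℓ
... | v , 1 , _ , ℓ≡ = v , trans ℓ≡ (*-identityˡ (2 ^ v))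
... | v , t@(suc (suc t′)) , odd , refl =
  -- The ground set has one element per column; `s≤s z≤n` gives 1 ≤ N because the columns begin with
  -- a singleton.
  contradiction (≤-trans (proj₂ (g-isMaximum (singleOne ℓ k) N) (suc C) ville) (g≤C N (s≤s z≤n)))
    1+n≰n
  where
  w N : ℕ
  w = 2 ^ v
  N = length (columns (suc C) w)
  w<ℓ : w < t * w
  w<ℓ = m<m+n w (≤-trans (m^n>0 2 v) (m≤m+n w (t′ * w)))
  ville : VilleOfSize (singleOne ℓ k) N (suc C)
  ville = oddlySplit⇒ville (fromColumns-injective w)
    (fromColumns-oddlySplit (suc C) w ℓ w<ℓ λ n →
      trans (choose-multiple (frobenius-2^ v) t n) (cong (choose n w ℙ.+_) odd))

-- The bound is 2ℓ - 1 for ℓ = `suc r`, one more than `¬oddlySplit` permits, which is enough for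
-- boundedness.
power⇒bounded : ∀ {r} → Frobenius (suc r) → suc r ≤ k →
                ∀ n → g (singleOne (suc r) k) n ≤ suc r + r
power⇒bounded {k} {r} fr q≤k n with g (singleOne (suc r) k) n ≤? suc r + r
... | yes g≤M = g≤M
... | no  g≰M = contradiction (oddlySplit-inject≤ (≰⇒≥ g≰M) (proj₂ family)) (¬oddlySplit fr _)
  where
  family : ∃ λ 𝓕 → OddlySplit {n = n} (suc r) 𝓕
  -- The ℓ-th coordinate has zero-based index r, so `suc r ≤ k` is read as r < k.
  family = ville⇒oddlySplit (fromℕ< q≤k) (cong suc (toℕ-fromℕ< q≤k))
    (proj₁ (g-isMaximum (singleOne (suc r) k) n))

theorem4 : ∀ (ℓ k : ℕ) → 2 ≤ ℓ → ℓ ≤ k →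
    (∃[ C ] ∀ (n : ℕ) → 1 ≤ n → g (singleOne ℓ k) n ≤ C) ⇔ (∃[ e ] ℓ ≡ 2 ^ e)
theorem4 ℓ@(suc r) k 2≤ℓ ℓ≤k = mk⇔ (bounded⇒power ℓ k (≤-trans (s≤s z≤n) 2≤ℓ))
  λ (e , ℓ≡2^e) → ℓ + r , λ n _ →
    power⇒bounded (subst Frobenius (sym ℓ≡2^e) (frobenius-2^ e)) ℓ≤k n
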